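{- Let $A$ be a set, let $L\subseteq A^*$ be a language and let $\mathcal{L}\colon\mathcal{O}_{\mathsf{Mon}}\to\mathsf{Set}$ be the functor encoding $L$. The minimal $(\mathcal{I}_{\mathsf{Mon}},\mathsf{Set},1,2)$-automaton $\mathsf{Min}(\mathcal{L})$ accepting $\mathcal{L}$ corresponds to the syntactic monoid $\mathsf{Syn}(L)$ of $L$: under the equivalence between $(\mathcal{I}_{\mathsf{Mon}},\mathsf{Set},1,2)$-automata and $A^*$-biaction recognizers, $\mathsf{Min}(\mathcal{L})$ corresponds (up to isomorphism) to the $A^*$-biaction recognizer underlying the monoid recognizer given by the quotient morphism $A^*\to\mathsf{Syn}(L)$ and the image of $L$.
   Context: The category $\mathcal{I}_{\mathsf{Mon}}$ has three objects $\mathsf{in},\mathsf{states},\mathsf{out}$. Its non-identity arrows are among: $\mathtt{w}\colon\mathsf{in}\to\mathsf{states}$ and $\overline{\mathtt{w}}\colon\mathsf{in}\to\mathsf{out}$, one of each for every $w\in A^*$; and $\mathtt{u}\square\mathtt{v}\colon\mathsf{states}\to\mathsf{states}$ and $\overline{\mathtt{u}\square\mathtt{v}}\colon\mathsf{states}\to\mathsf{out}$, one of each for every $(u,v)\in A^*\times A^*$ (with $\varepsilon\square\varepsilon$ the identity of $\mathsf{states}$). Composition is substitution for $\square$: $(\mathtt{u}\square\mathtt{v})\circ\mathtt{w}=\mathtt{uwv}$, $(\mathtt{u'}\square\mathtt{v'})\circ(\mathtt{u}\square\mathtt{v})=\mathtt{u'u}\square\mathtt{vv'}$, $\overline{\mathtt{u}\square\mathtt{v}}\circ\mathtt{w}=\overline{\mathtt{uwv}}$,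 $\overline{\mathtt{u'}\square\mathtt{v'}}\circ(\mathtt{u}\square\mathtt{v})=\overline{\mathtt{u'u}\square\mathtt{vv'}}$. $\mathcal{O}_{\mathsf{Mon}}$ is the full subcategory on $\mathsf{in},\mathsf{out}$, with inclusion $\iota$. Let $1=\{0\}$, $2=\{0,1\}$. The functor $\mathcal{L}$ encoding $L$ sends $\mathsf{in}$ to $1$, $\mathsf{out}$ to $2$, and $\mathcal{L}(\overline{\mathtt{w}})(0)=1$ iff $w\in L$. A $(\mathcal{I}_{\mathsf{Mon}},\mathsf{Set},1,2)$-automaton is a functor $\mathcal{A}\colon\mathcal{I}_{\mathsf{Mon}}\to\mathsf{Set}$ with $\mathcal{A}(\mathsf{in})=1$, $\mathcal{A}(\mathsf{out})=2$; it accepts $\mathcal{L}$ if $\mathcal{A}\circ\iota=\mathcal{L}$. Morphisms are natural transformations that are identities at $\mathsf{in}$ and $\mathsf{out}$. $\mathsf{Min}(\mathcal{L})$ is the automaton obtained by the (componentwise) surjection–injection factorization of the unique morphism from the initial automaton accepting $\mathcal{L}$ to the final automaton accepting $\mathcal{L}$. An $A^*$-biaction is a set $X$ with commuting left and right $A^*$-actions. An $A^*$-biaction recognizer is a pair $(\phi\colon A^*\to X,\ P\subseteq X)$ with $\phi$ a morphism of $A^*$-biactions and $P$ a subset; it recognizes $\{w\mid\phi(w)\in P\}$. The automaton $\mathcal{A}$ corresponds to the recognizer with $X=\mathcal{A}(\mathsf{states})$, $u\cdot x=\mathcal{A}(\mathtt{u}\square\varepsilon)(x)$, $x\cdot v=\mathcal{A}(\varepsilon\square\mathtt{v})(x)$,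 $\phi(w)=\mathcal{A}(\mathtt{w})(0)$, and $P$ the subset with characteristic function $\mathcal{A}(\overline{\varepsilon\square\varepsilon})$. A monoid recognizer is a pair $(\phi\colon A^*\to M,\ P\subseteq M)$ with $\phi$ a monoid morphism; it is an $A^*$-biaction recognizer via $u\cdot m=\phi(u)m$, $m\cdot v=m\phi(v)$. The syntactic monoid $\mathsf{Syn}(L)$ is the quotient of $A^*$ by the congruence $w\sim_L w'$ iff for all $u,v\in A^*$: $uwv\in L\Leftrightarrow uw'v\in L$. -}

module Defs where

open import Level using (Level; _⊔_; 0ℓ; Lift; lift) renaming (suc to lsuc)
open import Algebra.Bundles using (Monoid)
open import Algebra.Morphism.Structures using (module MonoidMorphisms)
open import Data.Fin.Base using (Fin; zero; suc)
open import Data.List.Base using (List; []; _++_; ++-[]-rawMonoid)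
open import Data.List.Properties using (++-assoc; ++-identityʳ)
open import Data.Product.Base using (Σ-syntax; ∃-syntax; _×_; _,_; proj₁)
open import Function.Base using (_∘′_)
open import Function.Bundles using (Func; _⇔_; mk⇔)
open import Function.Definitions using (Injective; Surjective)
import Function.Construct.Composition as Comp
import Function.Construct.Identity as Id
import Function.Construct.Symmetry as Symm
import Function.Relation.Binary.Setoid.Equality as FuncEq
open import Relation.Binary.Bundles using (Setoid)
open import Relation.Binary.Core using (Rel)
open import Relation.Binary.Definitions using (_Respects_)
open import Relation.Binary.PropositionalEquality
  using (_≡_; refl; sym; trans; cong; cong₂; subst; isEquivalence; module ≡-Reasoning)
import Relation.Binary.PropositionalEquality as ≡
open import Relation.Binary.Structures using (IsEquivalence)
open import Relation.Unary using (Pred; _∈_)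

record Category (o m e : Level) : Set (lsuc (o ⊔ m ⊔ e)) where
  infix  4 _≈_ _⇒_
  infixr 9 _∘_
  field
    Obj       : Set o
    _⇒_       : Obj → Obj → Set m
    _≈_       : ∀ {X Y} → X ⇒ Y → X ⇒ Y → Set e
    id        : ∀ {X} → X ⇒ X
    _∘_       : ∀ {X Y Z} → Y ⇒ Z → X ⇒ Y → X ⇒ Z
    equiv     : ∀ {X Y} → IsEquivalence (_≈_ {X} {Y})
    ∘-resp-≈  : ∀ {X Y Z} {g g′ : Y ⇒ Z} {f f′ : X ⇒ Y} →
                g ≈ g′ → f ≈ f′ → g ∘ f ≈ g′ ∘ f′
    assoc     : ∀ {W X Y Z} (h : Y ⇒ Z) (g : X ⇒ Y) (f : W ⇒ X) →
                (h ∘ g) ∘ f ≈ h ∘ (g ∘ f)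
    identityˡ : ∀ {X Y} (f : X ⇒ Y) → id ∘ f ≈ f
    identityʳ : ∀ {X Y} (f : X ⇒ Y) → f ∘ id ≈ f

fullSubcategory : ∀ {o m e p} (C : Category o m e) {P : Set p} →
                  (P → Category.Obj C) → Category p m e
fullSubcategory C {P} ι = record
  { Obj       = P
  ; _⇒_       = λ p q → ι p ⇒ ι q
  ; _≈_       = _≈_
  ; id        = id
  ; _∘_       = _∘_
  ; equiv     = equiv
  ; ∘-resp-≈  = ∘-resp-≈
  ; assoc     = assoc
  ; identityˡ = identityˡ
  ; identityʳ = identityʳ
  } where open Category C

-- The category of sets is modelled by setoids, so that quotients exist.
Sets : ∀ ℓ → Category (lsuc ℓ) ℓ ℓ
Sets ℓ = record
  { Obj       = Setoid ℓ ℓ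
  ; _⇒_       = Func
  ; _≈_       = λ {X} {Y} → FuncEq._≈_ X Y
  ; id        = λ {X} → Id.function X
  ; _∘_       = λ g f → Comp.function f g
  ; equiv     = λ {X} {Y} → FuncEq.isEquivalence X Y
  ; ∘-resp-≈  = λ {_} {_} {Z} {_} {g′} {f} {_} g≈g′ f≈f′ x →
                  Setoid.trans Z (g≈g′ (Func.to f x)) (Func.cong g′ (f≈f′ x))
  ; assoc     = λ {_} {_} {_} {Z} _ _ _ _ → Setoid.refl Z
  ; identityˡ = λ {_} {Y} _ _ → Setoid.refl Y
  ; identityʳ = λ {_} {Y} _ _ → Setoid.refl Y
  }

-- Functors with a prescribed object map, so that conditions such as
-- "𝒜 in = 1" or "𝒜 ∘ ι = 𝓛" need no transport along equalities of objects.
record FunctorOn {o m e o′ m′ e′} (C : Category o m e) (D : Category o′ m′ e′)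
                 (F₀ : Category.Obj C → Category.Obj D)
                 : Set (o ⊔ m ⊔ e ⊔ m′ ⊔ e′) where
  private
    module C = Category C
    module D = Category D
  field
    F₁           : ∀ {X Y} → X C.⇒ Y → F₀ X D.⇒ F₀ Y
    F-resp-≈     : ∀ {X Y} {f g : X C.⇒ Y} → f C.≈ g → F₁ f D.≈ F₁ g
    identity     : ∀ {X} → F₁ (C.id {X}) D.≈ D.id
    homomorphism : ∀ {X Y Z} (g : Y C.⇒ Z) (f : X C.⇒ Y) →
                   F₁ (g C.∘ f) D.≈ F₁ g D.∘ F₁ f

open FunctorOn public using (F₁)

-- Equality of functors with the same object map.
_≐_ : ∀ {o m e o′ m′ e′} {C : Category o m e} {D : Category o′ m′ e′}
      {F₀ : Category.Obj C → Category.Obj D} →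
      FunctorOn C D F₀ → FunctorOn C D F₀ → Set (o ⊔ m ⊔ e′)
_≐_ {C = C} {D} F G = ∀ X Y (f : X C.⇒ Y) → F₁ F f D.≈ F₁ G f
  where
  module C = Category C
  module D = Category D

restrict : ∀ {o m e o′ m′ e′ p} {C : Category o m e} {D : Category o′ m′ e′}
           {F₀ : Category.Obj C → Category.Obj D} →
           FunctorOn C D F₀ → {P : Set p} (ι : P → Category.Obj C) →
           FunctorOn (fullSubcategory C ι) D (F₀ ∘′ ι)
restrict F ι = record
  { F₁           = F₁ F
  ; F-resp-≈     = FunctorOn.F-resp-≈ F
  ; identity     = FunctorOn.identity F
  ; homomorphism = FunctorOn.homomorphism F
  }

record NaturalTransformation
         {o m e o′ m′ e′} {C : Category o m e} {D : Category o′ m′ e′}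
         {F₀ G₀ : Category.Obj C → Category.Obj D}
         (F : FunctorOn C D F₀) (G : FunctorOn C D G₀)
         : Set (o ⊔ m ⊔ m′ ⊔ e′) where
  private
    module C = Category C
    module D = Category D
  field
    component : ∀ X → F₀ X D.⇒ G₀ X
    natural   : ∀ {X Y} (f : X C.⇒ Y) →
                component Y D.∘ F₁ F f D.≈ F₁ G f D.∘ component X

data Endpoint : Set where
  In Out : Endpoint

data Object : Set where
  ι      : Endpoint → Object
  states : Object

pattern in′ = ι In
pattern out = ι Out

infix  8 _□_ _□‾_

-- The names ending in ‾ are the overlined arrows; [] □ [] is the identity
-- of states.
data Arrow {ℓ} (A : Set ℓ) : Object → Object → Set ℓ where
  id-in  : Arrow A in′ in′
  id-out : Arrow A out out
  word   : List A → Arrow A in′ states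
  word‾  : List A → Arrow A in′ out
  _□_    : List A → List A → Arrow A states states
  _□‾_   : List A → List A → Arrow A states out

module _ {ℓ} {A : Set ℓ} where

  idA : ∀ {X} → Arrow A X X
  idA {in′}    = id-in
  idA {out}    = id-out
  idA {states} = [] □ []

  infixr 9 _∘A_

  _∘A_ : ∀ {X Y Z} → Arrow A Y Z → Arrow A X Y → Arrow A X Z
  g          ∘A id-in    = g
  id-out     ∘A f        = f
  (u □ v)    ∘A word w   = word (u ++ w ++ v)
  (u □‾ v)   ∘A word w   = word‾ (u ++ w ++ v)
  (u′ □ v′)  ∘A (u □ v)  = (u′ ++ u) □ (v ++ v′)
  (u′ □‾ v′) ∘A (u □ v)  = (u′ ++ u) □‾ (v ++ v′)

  private
    -- (u′u) w (vv′) = u′ (uwv) v′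
    shuffle : ∀ (u′ u w v v′ : List A) →
              (u′ ++ u) ++ w ++ (v ++ v′) ≡ u′ ++ (u ++ w ++ v) ++ v′
    shuffle u′ u w v v′ = begin
      (u′ ++ u) ++ w ++ (v ++ v′)   ≡⟨ ++-assoc u′ u _ ⟩
      u′ ++ u ++ w ++ v ++ v′       ≡⟨ cong (λ z → u′ ++ u ++ z) (++-assoc w v v′) ⟨
      u′ ++ u ++ (w ++ v) ++ v′     ≡⟨ cong (u′ ++_) (++-assoc u (w ++ v) v′) ⟨
      u′ ++ (u ++ w ++ v) ++ v′     ∎
      where open ≡-Reasoning

  assocA : ∀ {W X Y Z} (h : Arrow A Y Z) (g : Arrow A X Y) (f : Arrow A W X) →
           (h ∘A g) ∘A f ≡ h ∘A (g ∘A f)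
  assocA h      g      id-in     = refl
  assocA id-out id-out id-out    = refl
  assocA id-out id-out (word‾ _) = refl
  assocA id-out id-out (_ □‾ _)  = refl
  assocA id-out (_ □‾ _) (word _) = refl
  assocA id-out (_ □‾ _) (_ □ _) = refl
  assocA (u′ □ v′)  (u □ v) (word w) = cong word (shuffle u′ u w v v′)
  assocA (u′ □‾ v′) (u □ v) (word w) = cong word‾ (shuffle u′ u w v v′)
  assocA (u″ □ v″)  (u′ □ v′) (u □ v) =
    cong₂ _□_ (++-assoc u″ u′ u) (sym (++-assoc v v′ v″))
  assocA (u″ □‾ v″) (u′ □ v′) (u □ v) =
    cong₂ _□‾_ (++-assoc u″ u′ u) (sym (++-assoc v v′ v″))

  identityˡA : ∀ {X Y} (f : Arrow A X Y) → idA ∘A f ≡ f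
  identityˡA id-in     = refl
  identityˡA id-out    = refl
  identityˡA (word w)  = cong word (++-identityʳ w)
  identityˡA (word‾ w) = refl
  identityˡA (u □ v)   = cong (u □_) (++-identityʳ v)
  identityˡA (u □‾ v)  = refl

  identityʳA : ∀ {X Y} (f : Arrow A X Y) → f ∘A idA ≡ f
  identityʳA id-in     = refl
  identityʳA id-out    = refl
  identityʳA (word w)  = refl
  identityʳA (word‾ w) = refl
  identityʳA (u □ v)   = cong (_□ v) (++-identityʳ u)
  identityʳA (u □‾ v)  = cong (_□‾ v) (++-identityʳ u)

I-Mon : ∀ {ℓ} → Set ℓ → Category 0ℓ ℓ ℓ
I-Mon A = record
  { Obj       = Object
  ; _⇒_       = Arrow A
  ; _≈_       = _≡_
  ; id        = idA
  ; _∘_       = _∘A_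
  ; equiv     = isEquivalence
  ; ∘-resp-≈  = cong₂ _∘A_
  ; assoc     = assocA
  ; identityˡ = identityˡA
  ; identityʳ = identityʳA
  }

O-Mon : ∀ {ℓ} → Set ℓ → Category 0ℓ ℓ ℓ
O-Mon A = fullSubcategory (I-Mon A) ι

𝟙 : ∀ {ℓ} → Setoid ℓ ℓ
𝟙 {ℓ} = ≡.setoid (Lift ℓ (Fin 1))

𝟚 : ∀ {ℓ} → Setoid ℓ ℓ
𝟚 {ℓ} = ≡.setoid (Lift ℓ (Fin 2))

endpoints : ∀ {ℓ} → Endpoint → Setoid ℓ ℓ
endpoints In  = 𝟙
endpoints Out = 𝟚

objects : ∀ {ℓ} → Setoid ℓ ℓ → Object → Setoid ℓ ℓ
objects S (ι p)  = endpoints p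
objects S states = S

module _ {ℓ} (A : Set ℓ) where

  -- Functors 𝓛 from O-Mon to Sets with 𝓛 in = 1 and 𝓛 out = 2.
  LanguageFunctor : Set ℓ
  LanguageFunctor = FunctorOn (O-Mon A) (Sets ℓ) endpoints

  -- Functors 𝒜 from I-Mon to Sets with 𝒜 in = 1 and 𝒜 out = 2.
  record Automaton : Set (lsuc ℓ) where
    field
      stateSet : Setoid ℓ ℓ
      functor  : FunctorOn (I-Mon A) (Sets ℓ) (objects stateSet)

module _ {ℓ} {A : Set ℓ} where

  -- Since 𝓛 takes values in the two-element set, this makes membership in L
  -- decidable.
  _Encodes_ : LanguageFunctor A → Pred (List A) ℓ → Set ℓ
  𝓛 Encodes L = ∀ w →
    (Func.to (F₁ 𝓛 (word‾ w)) (lift zero) ≡ lift (suc zero)) ⇔ (w ∈ L)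

  _Accepts_ : Automaton A → LanguageFunctor A → Set ℓ
  𝒜 Accepts 𝓛 = restrict (Automaton.functor 𝒜) ι ≐ 𝓛

  record _⇒ᴬ_ (𝒜 ℬ : Automaton A) : Set ℓ where
    field
      transformation : NaturalTransformation (Automaton.functor 𝒜) (Automaton.functor ℬ)
    open NaturalTransformation transformation public
    field
      identity-at-endpoints :
        ∀ p → Category._≈_ (Sets ℓ) (component (ι p)) (Category.id (Sets ℓ))

  open _⇒ᴬ_ using (component)

  _≈ᴬ_ : ∀ {𝒜 ℬ : Automaton A} → 𝒜 ⇒ᴬ ℬ → 𝒜 ⇒ᴬ ℬ → Set ℓ
  f ≈ᴬ g = ∀ X → component f X ≈ component g X
    where open Category (Sets ℓ)

  IsInitialAccepting : LanguageFunctor A → Automaton A → Set (lsuc ℓ)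
  IsInitialAccepting 𝓛 𝒜 = 𝒜 Accepts 𝓛 ×
    (∀ ℬ → ℬ Accepts 𝓛 → Σ[ f ∈ 𝒜 ⇒ᴬ ℬ ] (∀ g → g ≈ᴬ f))

  IsFinalAccepting : LanguageFunctor A → Automaton A → Set (lsuc ℓ)
  IsFinalAccepting 𝓛 𝒜 = 𝒜 Accepts 𝓛 ×
    (∀ ℬ → ℬ Accepts 𝓛 → Σ[ f ∈ ℬ ⇒ᴬ 𝒜 ] (∀ g → g ≈ᴬ f))

  -- ℳ is the middle object of a componentwise surjection–injection
  -- factorization of the (unique) morphism from an initial to a final
  -- automaton accepting 𝓛.
  record IsMin (𝓛 : LanguageFunctor A) (ℳ : Automaton A) : Set (lsuc ℓ) where
    field
      {initial final} : Automaton A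
      isInitial  : IsInitialAccepting 𝓛 initial
      isFinal    : IsFinalAccepting 𝓛 final
      unique     : initial ⇒ᴬ final
      surjection : initial ⇒ᴬ ℳ
      injection  : ℳ ⇒ᴬ final
    private module 𝐒 = Category (Sets ℓ)
    field
      surjective : ∀ X → Surjective (Setoid._≈_ (objects (Automaton.stateSet initial) X))
                                    (Setoid._≈_ (objects (Automaton.stateSet ℳ) X))
                                    (Func.to (component surjection X))
      injective  : ∀ X → Injective (Setoid._≈_ (objects (Automaton.stateSet ℳ) X))
                                   (Setoid._≈_ (objects (Automaton.stateSet final) X))
                                   (Func.to (component injection X))
      factorizes : ∀ X → (component injection X 𝐒.∘ component surjection X)
                         𝐒.≈ component unique X

record Biaction {ℓ} (A : Set ℓ) : Set (lsuc ℓ) where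
  infixr 7 _▷_
  infixl 7 _◁_
  field
    setoid : Setoid ℓ ℓ
  open Setoid setoid public
  field
    _▷_     : List A → Carrier → Carrier
    _◁_     : Carrier → List A → Carrier
    ▷-cong  : ∀ u {x y} → x ≈ y → u ▷ x ≈ u ▷ y
    ◁-cong  : ∀ v {x y} → x ≈ y → x ◁ v ≈ y ◁ v
    ▷-empty : ∀ x → [] ▷ x ≈ x
    ◁-empty : ∀ x → x ◁ [] ≈ x
    ▷-++    : ∀ u u′ x → (u ++ u′) ▷ x ≈ u ▷ (u′ ▷ x)
    ◁-++    : ∀ x v v′ → x ◁ (v ++ v′) ≈ (x ◁ v) ◁ v′
    commute : ∀ u x v → u ▷ (x ◁ v) ≈ (u ▷ x) ◁ v

record BiactionMorphism {ℓ} {A : Set ℓ} (X Y : Biaction A) : Set ℓ where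
  private
    module X = Biaction X
    module Y = Biaction Y
  field
    function : Func X.setoid Y.setoid
  open Func function public
  field
    ▷-homo : ∀ u x → to (u X.▷ x) Y.≈ u Y.▷ to x
    ◁-homo : ∀ x v → to (x X.◁ v) Y.≈ to x Y.◁ v

words : ∀ {ℓ} (A : Set ℓ) → Biaction A
words A = record
  { setoid  = ≡.setoid (List A)
  ; _▷_     = _++_
  ; _◁_     = _++_
  ; ▷-cong  = λ u → cong (u ++_)
  ; ◁-cong  = λ v → cong (_++ v)
  ; ▷-empty = λ _ → refl
  ; ◁-empty = ++-identityʳ
  ; ▷-++    = ++-assoc
  ; ◁-++    = λ x v v′ → sym (++-assoc x v v′)
  ; commute = λ u x v → sym (++-assoc u x v)
  }

record BiactionRecognizer {ℓ} (A : Set ℓ) : Set (lsuc ℓ) where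
  field
    biaction : Biaction A
    φ        : BiactionMorphism (words A) biaction
  open Biaction biaction public
  field
    P        : Pred Carrier ℓ
    P-resp-≈ : P Respects _≈_

module _ {ℓ} {A : Set ℓ} where

  record RecognizerMorphism (R S : BiactionRecognizer A) : Set ℓ where
    private
      module R = BiactionRecognizer R
      module S = BiactionRecognizer S
    field
      morphism : BiactionMorphism R.biaction S.biaction
    open BiactionMorphism morphism public
    field
      preserves-φ : ∀ w → to (BiactionMorphism.to R.φ w) S.≈ BiactionMorphism.to S.φ w
      preserves-P : ∀ x → (x ∈ R.P) ⇔ (to x ∈ S.P)

  infix 4 _≅_

  record _≅_ (R S : BiactionRecognizer A) : Set ℓ where
    private
      module R = BiactionRecognizer R
      module S = BiactionRecognizer S
    field
      forward  : RecognizerMorphism R S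
      backward : RecognizerMorphism S R
    private
      module F = RecognizerMorphism forward
      module B = RecognizerMorphism backward
    field
      backward∘forward : ∀ x → B.to (F.to x) R.≈ x
      forward∘backward : ∀ y → F.to (B.to y) S.≈ y

  recognizer : Automaton A → BiactionRecognizer A
  recognizer 𝒜 = record
    { biaction = record
      { setoid  = stateSet
      ; _▷_     = λ u → act (u □ [])
      ; _◁_     = λ x v → act ([] □ v) x
      ; ▷-cong  = λ u → Func.cong (F₁ functor (u □ []))
      ; ◁-cong  = λ v → Func.cong (F₁ functor ([] □ v))
      ; ▷-empty = identity {states}
      ; ◁-empty = identity {states}
      ; ▷-++    = λ u u′ → homomorphism (u □ []) (u′ □ [])
      ; ◁-++    = λ x v v′ → homomorphism ([] □ v′) ([] □ v) x
      ; commute = λ u x v → S.trans (S.sym (homomorphism (u □ []) ([] □ v) x))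
                   (S.trans (F-resp-≈ (cong₂ _□_ (++-identityʳ u) (++-identityʳ v)) x)
                   (homomorphism ([] □ v) (u □ []) x))
      }
    ; φ = record
      { function = record
        { to   = φ₀
        ; cong = λ { refl → S.refl }
        }
      ; ▷-homo = λ u w → S.trans
          (F-resp-≈ (cong (λ z → word (u ++ z)) (sym (++-identityʳ w))) (lift zero))
          (homomorphism (u □ []) (word w) (lift zero))
      ; ◁-homo = λ w v → homomorphism ([] □ v) (word w) (lift zero)
      }
    ; P        = λ x → Func.to (F₁ functor ([] □‾ [])) x ≡ lift (suc zero)
    ; P-resp-≈ = λ x≈y → trans (sym (Func.cong (F₁ functor ([] □‾ [])) x≈y))
    }
    where
    open Automaton 𝒜
    open FunctorOn functor using (F-resp-≈; identity; homomorphism)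
    module S = Setoid stateSet

    act : Arrow A states states → S.Carrier → S.Carrier
    act f = Func.to (F₁ functor f)

    φ₀ : List A → S.Carrier
    φ₀ w = Func.to (F₁ functor (word w)) (lift zero)

record MonoidRecognizer {ℓ} (A : Set ℓ) : Set (lsuc ℓ) where
  field
    monoid : Monoid ℓ ℓ
  open Monoid monoid public
  field
    φ              : List A → Carrier
    isHomomorphism : MonoidMorphisms.IsMonoidHomomorphism (++-[]-rawMonoid A) rawMonoid φ
    P              : Pred Carrier ℓ
    P-resp-≈       : P Respects _≈_

module _ {ℓ} {A : Set ℓ} where

  underlying : MonoidRecognizer A → BiactionRecognizer A
  underlying R = record
    { biaction = record
      { setoid  = M.setoid
      ; _▷_     = λ u m → M.φ u M.∙ m
      ; _◁_     = λ m v → m M.∙ M.φ v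
      ; ▷-cong  = λ _ → M.∙-congˡ
      ; ◁-cong  = λ _ → M.∙-congʳ
      ; ▷-empty = λ m → M.trans (M.∙-congʳ ε-homo) (M.identityˡ m)
      ; ◁-empty = λ m → M.trans (M.∙-congˡ ε-homo) (M.identityʳ m)
      ; ▷-++    = λ u u′ m → M.trans (M.∙-congʳ (homo u u′)) (M.assoc _ _ m)
      ; ◁-++    = λ m v v′ → M.trans (M.∙-congˡ (homo v v′)) (M.sym (M.assoc m _ _))
      ; commute = λ _ m _ → M.sym (M.assoc _ m _)
      }
    ; φ = record
      { function = record { to = M.φ ; cong = ⟦⟧-cong }
      ; ▷-homo   = homo
      ; ◁-homo   = homo
      }
    ; P        = M.P
    ; P-resp-≈ = M.P-resp-≈
    }
    where
    module M = MonoidRecognizer R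
    open MonoidMorphisms.IsMonoidHomomorphism M.isHomomorphism

  module _ (L : Pred (List A) ℓ) where

    _∼_ : Rel (List A) ℓ
    w ∼ w′ = ∀ u v → (u ++ w ++ v ∈ L) ⇔ (u ++ w′ ++ v ∈ L)

    ∼-isEquivalence : IsEquivalence _∼_
    ∼-isEquivalence = record
      { refl  = λ u v → Id.⇔-id _
      ; sym   = λ p u v → Symm.⇔-sym (p u v)
      ; trans = λ p q u v → q u v Comp.⇔-∘ p u v
      }

    private
      ≡⇒∼ : ∀ {w w′} → w ≡ w′ → w ∼ w′
      ≡⇒∼ refl = IsEquivalence.refl ∼-isEquivalence

      reassoc : ∀ {w w′} → w ≡ w′ → (w ∈ L) ⇔ (w′ ∈ L)
      reassoc eq = mk⇔ (subst L eq) (subst L (sym eq))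

      ∼-congʳ : ∀ {x x′} y → x ∼ x′ → (x ++ y) ∼ (x′ ++ y)
      ∼-congʳ {x} {x′} y p u v =
        reassoc (cong (u ++_) (sym (++-assoc x′ y v))) Comp.⇔-∘ (p u (y ++ v)
          Comp.⇔-∘ reassoc (cong (u ++_) (++-assoc x y v)))

      ∼-congˡ : ∀ x {y y′} → y ∼ y′ → (x ++ y) ∼ (x ++ y′)
      ∼-congˡ x {y} {y′} q u v =
        reassoc (shift y′) Comp.⇔-∘ (q (u ++ x) v Comp.⇔-∘ reassoc (sym (shift y)))
        where
        shift : ∀ z → (u ++ x) ++ z ++ v ≡ u ++ (x ++ z) ++ v
        shift z = trans (++-assoc u x (z ++ v)) (cong (u ++_) (sym (++-assoc x z v)))

      ∼-cong : ∀ {x x′ y y′} → x ∼ x′ → y ∼ y′ → (x ++ y) ∼ (x′ ++ y′)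
      ∼-cong {x′ = x′} {y = y} p q =
        IsEquivalence.trans ∼-isEquivalence (∼-congʳ y p) (∼-congˡ x′ q)

    Syn : Monoid ℓ ℓ
    Syn = record
      { Carrier  = List A
      ; _≈_      = _∼_
      ; _∙_      = _++_
      ; ε        = []
      ; isMonoid = record
        { isSemigroup = record
          { isMagma = record
            { isEquivalence = ∼-isEquivalence
            ; ∙-cong        = ∼-cong
            }
          ; assoc = λ x y z → ≡⇒∼ (++-assoc x y z)
          }
        ; identity = (λ _ → ≡⇒∼ refl) , λ x → ≡⇒∼ (++-identityʳ x)
        }
      }

    -- The quotient morphism is the identity on underlying words; the subset
    -- is the image of L along it.
    syntactic : MonoidRecognizer A
    syntactic = record
      { monoid         = Syn
      ; φ              = λ w → w
      ; isHomomorphism = record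
        { isMagmaHomomorphism = record
          { isRelHomomorphism = record { cong = ≡⇒∼ }
          ; homo              = λ _ _ → ≡⇒∼ refl
          }
        ; ε-homo = ≡⇒∼ refl
        }
      ; P        = λ m → ∃[ w ] (w ∈ L × w ∼ m)
      ; P-resp-≈ = λ m∼m′ (w , w∈L , w∼m) →
                     w , w∈L , IsEquivalence.trans ∼-isEquivalence w∼m m∼m′
      }

{-# OPTIONS --safe #-}

-- An automaton accepting 𝓛 corresponds to Syn(L) as soon as every state is
-- reached by some word and states with the same outputs along all arrows
-- states → out are equal: sending a state to a word reaching it is then a
-- bijection onto words modulo ∼. The words form an initial automaton and the
-- functions A* × A* → 2 a final one; by uniqueness every initial automaton is
-- a retract of the former (hence reachable) and every final automaton a
-- retract of the latter (hence separated). Surjections transport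
-- reachability, injections reflect separation.

module Submission where

open import Level using (Lift; lift)
open import Data.Fin.Base using (Fin; zero; suc)
open import Data.List.Base using (List; []; _++_)
open import Data.List.Properties using (++-assoc; ++-identityʳ)
open import Data.Product.Base using (Σ-syntax; ∃-syntax; _×_; _,_; proj₁; proj₂)
open import Function.Base using (id)
open import Function.Bundles using (Func; _⇔_; mk⇔; module Equivalence)
import Function.Construct.Composition as Comp
import Function.Construct.Identity as Id
import Function.Construct.Symmetry as Symm
open import Relation.Binary.Bundles using (Setoid)
open import Relation.Binary.PropositionalEquality
  using (_≡_; refl; sym; trans; cong; subst)
import Relation.Binary.Reasoning.Setoid as SetoidReasoning
open import Relation.Binary.Structures using (IsEquivalence)
open import Relation.Unary using (Pred; _∈_)
open import Defs

-- Truth values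

pattern ⋆     = lift zero
pattern true₂ = lift (suc zero)

-- The only value other than `true₂` is 0, so being `true₂` determines a value. This turns
-- equivalences of memberships into equations between outputs.
≡-of-⇔ : ∀ {ℓ} (a b : Lift ℓ (Fin 2)) → (a ≡ true₂) ⇔ (b ≡ true₂) → a ≡ b
≡-of-⇔ (lift zero) (lift zero) _ = refl
≡-of-⇔ (lift zero) true₂       p = Equivalence.from p refl
≡-of-⇔ true₂       b           p = sym (Equivalence.to p refl)

≡⇒⇔ : ∀ {ℓ} {X : Set ℓ} {a b : X} (c : X) → a ≡ b → (a ≡ c) ⇔ (b ≡ c)
≡⇒⇔ c refl = Id.⇔-id _

-- Reachability, separation and morphisms of automata

module _ {ℓ} {A : Set ℓ} where

  open _⇒ᴬ_ using (component; natural; identity-at-endpoints)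

  States : Automaton A → Set ℓ
  States 𝒜 = Setoid.Carrier (Automaton.stateSet 𝒜)

  run : ∀ (𝒜 : Automaton A) {X Y} → Arrow A X Y →
        Setoid.Carrier (objects (Automaton.stateSet 𝒜) X) →
        Setoid.Carrier (objects (Automaton.stateSet 𝒜) Y)
  run 𝒜 f = Func.to (F₁ (Automaton.functor 𝒜) f)

  reach : (𝒜 : Automaton A) → List A → States 𝒜
  reach 𝒜 w = run 𝒜 (word w) ⋆

  mapState : ∀ {𝒜 ℬ : Automaton A} → 𝒜 ⇒ᴬ ℬ → States 𝒜 → States ℬ
  mapState f = Func.to (component f states)

  Reachable : Automaton A → Set ℓ
  Reachable 𝒜 = ∀ x → ∃[ w ] reach 𝒜 w ≈ x
    where open Setoid (Automaton.stateSet 𝒜)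

  -- For an accepting automaton this is the kernel of `toContexts`, the map to the final automaton.
  Indistinguishable : (𝒜 : Automaton A) → States 𝒜 → States 𝒜 → Set ℓ
  Indistinguishable 𝒜 x y = ∀ u v → run 𝒜 (u □‾ v) x ≡ run 𝒜 (u □‾ v) y

  Separated : Automaton A → Set ℓ
  Separated 𝒜 = ∀ {x y} → Indistinguishable 𝒜 x y → x ≈ y
    where open Setoid (Automaton.stateSet 𝒜)

  idᴬ : ∀ {𝒜 : Automaton A} → 𝒜 ⇒ᴬ 𝒜
  idᴬ {𝒜} = record
    { transformation = record
      { component = λ _ → Category.id (Sets ℓ)
      ; natural   = λ {_} {Y} _ _ → Setoid.refl (objects (Automaton.stateSet 𝒜) Y)
      }
    ; identity-at-endpoints = λ p _ → Setoid.refl (endpoints p)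
    }

  infixr 9 _∘ᴬ_

  _∘ᴬ_ : ∀ {𝒜 ℬ 𝒞 : Automaton A} → ℬ ⇒ᴬ 𝒞 → 𝒜 ⇒ᴬ ℬ → 𝒜 ⇒ᴬ 𝒞
  _∘ᴬ_ {𝒞 = 𝒞} g f = record
    { transformation = record
      { component = λ X → component g X 𝐒.∘ component f X
      ; natural   = λ {X} {Y} a x →
          Setoid.trans (objects (Automaton.stateSet 𝒞) Y)
            (Func.cong (component g Y) (natural f a x))
            (natural g a (Func.to (component f X) x))
      }
    ; identity-at-endpoints = λ p x → Setoid.trans (endpoints p)
        (Func.cong (component g (ι p)) (identity-at-endpoints f p x))
        (identity-at-endpoints g p x)
    }
    where module 𝐒 = Category (Sets ℓ)

  module _ {𝒜 ℬ : Automaton A} (f : 𝒜 ⇒ᴬ ℬ) where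
    private
      module 𝒜 = Automaton 𝒜
      module ℬ = Automaton ℬ

    -- Naturality at `word w` and the identity at `in′` force the image of a reached state.
    -- Uniqueness of morphisms out of `wordAutomaton` rests on this; `mapState-output` plays the
    -- dual part for morphisms into `contextAutomaton`.
    mapState-reach : ∀ w → Setoid._≈_ ℬ.stateSet (mapState f (reach 𝒜 w)) (reach ℬ w)
    mapState-reach w = Setoid.trans ℬ.stateSet (natural f (word w) ⋆)
      (Func.cong (F₁ ℬ.functor (word w)) (identity-at-endpoints f In ⋆))

    mapState-output : ∀ u v x → run ℬ (u □‾ v) (mapState f x) ≡ run 𝒜 (u □‾ v) x
    mapState-output u v x = trans (sym (natural f (u □‾ v) x))
      (identity-at-endpoints f Out (run 𝒜 (u □‾ v) x))

    -- Acceptance concerns only arrows between endpoints, where the components of `f` are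
    -- identities.
    Accepts-reflects : ∀ {𝓛} → ℬ Accepts 𝓛 → 𝒜 Accepts 𝓛
    Accepts-reflects {𝓛} acc p q a x = begin
      run 𝒜 a x                                    ≈⟨ identity-at-endpoints f q _ ⟨
      Func.to (component f (ι q)) (run 𝒜 a x)      ≈⟨ natural f a x ⟩
      run ℬ a (Func.to (component f (ι p)) x)
        ≈⟨ Func.cong (F₁ ℬ.functor a) (identity-at-endpoints f p x) ⟩
      run ℬ a x                                    ≈⟨ acc p q a x ⟩
      Func.to (F₁ 𝓛 a) x                           ∎
      where open SetoidReasoning (endpoints q)

    Indistinguishable-preserved : ∀ {x y} → Indistinguishable 𝒜 x y →
      Indistinguishable ℬ (mapState f x) (mapState f y)
    Indistinguishable-preserved x≃y u v = trans (mapState-output u v _)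
      (trans (x≃y u v) (sym (mapState-output u v _)))

  -- Automata built from biactions

  -- The converse of recognizer, with a characteristic function instead of a subset.
  automaton : (X : Biaction A) → BiactionMorphism (words A) X →
              Func (Biaction.setoid X) 𝟚 → Automaton A
  automaton X φ χ = record
    { stateSet = X.setoid
    ; functor  = record
      { F₁           = arr
      ; F-resp-≈     = λ { {_} {Y} refl _ → Setoid.refl (objects X.setoid Y) }
      ; identity     = λ {Y} → identity {Y}
      ; homomorphism = homomorphism
      }
    }
    where
    module X = Biaction X
    module φ = BiactionMorphism φ
    module χ = Func χ

    -- The right action comes first to match the bracketing of `u ++ w ++ v`; on `words A` the two
    -- agree by definition.
    act : List A → List A → X.Carrier → X.Carrier
    act u v x = u X.▷ (x X.◁ v)

    act-cong : ∀ u v {x y} → x X.≈ y → act u v x X.≈ act u v y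
    act-cong u v x≈y = X.▷-cong u (X.◁-cong v x≈y)

    act-φ : ∀ u v w → φ.to (u ++ w ++ v) X.≈ act u v (φ.to w)
    act-φ u v w = X.trans (φ.▷-homo u (w ++ v)) (X.▷-cong u (φ.◁-homo w v))

    act-act : ∀ u′ v′ u v x → act (u′ ++ u) (v ++ v′) x X.≈ act u′ v′ (act u v x)
    act-act u′ v′ u v x = begin
      (u′ ++ u) X.▷ (x X.◁ (v ++ v′))      ≈⟨ X.▷-++ u′ u _ ⟩
      u′ X.▷ u X.▷ (x X.◁ (v ++ v′))
        ≈⟨ X.▷-cong u′ (X.▷-cong u (X.◁-++ x v v′)) ⟩
      u′ X.▷ u X.▷ ((x X.◁ v) X.◁ v′)      ≈⟨ X.▷-cong u′ (X.commute u (x X.◁ v) v′) ⟩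
      u′ X.▷ ((u X.▷ (x X.◁ v)) X.◁ v′)    ∎
      where open SetoidReasoning X.setoid

    arr : ∀ {Y Z} → Arrow A Y Z → Func (objects X.setoid Y) (objects X.setoid Z)
    arr id-in     = Id.function _
    arr id-out    = Id.function _
    arr (word w)  = record { to = λ _ → φ.to w ; cong = λ _ → X.refl }
    arr (word‾ w) = record { to = λ _ → χ.to (φ.to w) ; cong = λ _ → refl }
    arr (u □ v)   = record { to = act u v ; cong = act-cong u v }
    arr (u □‾ v)  = record { to   = λ x → χ.to (act u v x)
                           ; cong = λ x≈y → χ.cong (act-cong u v x≈y) }

    identity : ∀ {Y} (x : Setoid.Carrier (objects X.setoid Y)) →
               Setoid._≈_ (objects X.setoid Y) (Func.to (arr (idA {X = Y})) x) x
    identity {in′}    _ = refl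
    identity {out}    _ = refl
    identity {states} x = X.trans (X.▷-empty _) (X.◁-empty x)

    homomorphism : ∀ {W Y Z} (g : Arrow A Y Z) (f : Arrow A W Y)
                   (x : Setoid.Carrier (objects X.setoid W)) →
                   Setoid._≈_ (objects X.setoid Z)
                     (Func.to (arr (g ∘A f)) x) (Func.to (arr g) (Func.to (arr f) x))
    homomorphism {Z = Z} g id-in    _ = Setoid.refl (objects X.setoid Z)
    homomorphism id-out    id-out    _ = refl
    homomorphism id-out    (word‾ _) _ = refl
    homomorphism id-out    (_ □‾ _)  _ = refl
    homomorphism (u □ v)   (word w)  _ = act-φ u v w
    homomorphism (u □‾ v)  (word w)  _ = χ.cong (act-φ u v w)
    homomorphism (u′ □ v′) (u □ v)   x = act-act u′ v′ u v x
    homomorphism (u′ □‾ v′) (u □ v)  x = χ.cong (act-act u′ v′ u v x)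

  -- Automata accepting a fixed language

  module _ (𝓛 : LanguageFunctor A) where

    output : List A → Lift ℓ (Fin 2)
    output w = Func.to (F₁ 𝓛 (word‾ w)) ⋆

    -- The composite of `word w` and `u □‾ v` runs between endpoints, where `𝒜` agrees with `𝓛`.
    Accepts⇒output : ∀ {𝒜} → 𝒜 Accepts 𝓛 → ∀ u v w →
                     run 𝒜 (u □‾ v) (reach 𝒜 w) ≡ output (u ++ w ++ v)
    Accepts⇒output {𝒜} acc u v w =
      trans (sym (FunctorOn.homomorphism (Automaton.functor 𝒜) (u □‾ v) (word w) ⋆))
            (acc In Out (word‾ (u ++ w ++ v)) ⋆)

    -- Besides the arrows `word‾ w`, only identities run between endpoints, and functors preserve
    -- those.
    automaton-Accepts : ∀ X φ χ →
      (∀ w → Func.to χ (BiactionMorphism.to φ w) ≡ output w) → automaton X φ χ Accepts 𝓛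
    automaton-Accepts X φ χ eq In  In  id-in     x = sym (FunctorOn.identity 𝓛 {In} x)
    automaton-Accepts X φ χ eq In  Out (word‾ w) ⋆ = eq w
    automaton-Accepts X φ χ eq Out Out id-out    x = sym (FunctorOn.identity 𝓛 {Out} x)

    -- With identities as components at the endpoints, naturality between endpoints follows from
    -- both automata accepting `𝓛`; only arrows touching `states` need hypotheses.
    mkMorphism : ∀ {𝒜 ℬ : Automaton A} → 𝒜 Accepts 𝓛 → ℬ Accepts 𝓛 →
      (f : Func (Automaton.stateSet 𝒜) (Automaton.stateSet ℬ)) →
      (∀ w → Setoid._≈_ (Automaton.stateSet ℬ) (Func.to f (reach 𝒜 w)) (reach ℬ w)) →
      (∀ u v x → Setoid._≈_ (Automaton.stateSet ℬ)
         (Func.to f (run 𝒜 (u □ v) x)) (run ℬ (u □ v) (Func.to f x))) →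
      (∀ u v x → run 𝒜 (u □‾ v) x ≡ run ℬ (u □‾ v) (Func.to f x)) →
      𝒜 ⇒ᴬ ℬ
    mkMorphism {𝒜} {ℬ} acc𝒜 accℬ f f-word f-act f-output = record
      { transformation = record { component = comp ; natural = nat }
      ; identity-at-endpoints = λ p _ → Setoid.refl (endpoints p)
      }
      where
      comp : ∀ X → Func (objects (Automaton.stateSet 𝒜) X) (objects (Automaton.stateSet ℬ) X)
      comp (ι _)  = Id.function _
      comp states = f

      endpoint : ∀ {p q} (a : Arrow A (ι p) (ι q)) x →
                 Setoid._≈_ (endpoints q) (run 𝒜 a x) (run ℬ a x)
      endpoint {p} {q} a x = Setoid.trans (endpoints q) (acc𝒜 p q a x)
                               (Setoid.sym (endpoints q) (accℬ p q a x))

      nat : ∀ {X Y} (a : Arrow A X Y) x →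
            Setoid._≈_ (objects (Automaton.stateSet ℬ) Y)
              (Func.to (comp Y) (run 𝒜 a x)) (run ℬ a (Func.to (comp X) x))
      nat id-in     x = endpoint id-in x
      nat id-out    x = endpoint id-out x
      nat (word w)  ⋆ = f-word w
      nat (word‾ w) x = endpoint (word‾ w) x
      nat (u □ v)   x = f-act u v x
      nat (u □‾ v)  x = f-output u v x

    -- The initial accepting automaton

    wordAutomaton : Automaton A
    wordAutomaton = automaton (words A)
      (record { function = Id.function _ ; ▷-homo = λ _ _ → refl ; ◁-homo = λ _ _ → refl })
      (record { to = output ; cong = cong output })

    wordAutomaton-Accepts : wordAutomaton Accepts 𝓛
    wordAutomaton-Accepts = automaton-Accepts _ _ _ λ _ → refl

    fromWords : ∀ ℬ → ℬ Accepts 𝓛 → wordAutomaton ⇒ᴬ ℬ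
    fromWords ℬ acc = mkMorphism wordAutomaton-Accepts acc
      (record { to = reach ℬ ; cong = λ { refl → Setoid.refl (Automaton.stateSet ℬ) } })
      (λ _ → Setoid.refl (Automaton.stateSet ℬ))
      (λ u v w → FunctorOn.homomorphism (Automaton.functor ℬ) (u □ v) (word w) ⋆)
      (λ u v w → sym (Accepts⇒output {ℬ} acc u v w))

    -- In `wordAutomaton` the state `w` is reached by the word `w`, so `mapState-reach` determines
    -- every morphism on all states.
    wordAutomaton-isInitial : IsInitialAccepting 𝓛 wordAutomaton
    wordAutomaton-isInitial = wordAutomaton-Accepts , λ ℬ acc → fromWords ℬ acc , λ g → λ
      { (ι p)  → identity-at-endpoints g p
      ; states → mapState-reach g
      }

    -- The final accepting automaton

    contexts : Biaction A
    contexts = record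
      { setoid  = record
        { Carrier       = List A → List A → Lift ℓ (Fin 2)
        ; _≈_           = λ f g → ∀ u v → f u v ≡ g u v
        ; isEquivalence = record
          { refl  = λ _ _ → refl
          ; sym   = λ p u v → sym (p u v)
          ; trans = λ p q u v → trans (p u v) (q u v)
          }
        }
      -- Acting by a word moves it into the context, on the side next to the state: `u` goes to the
      -- end of the left context, `v` to the start of the right one.
      ; _▷_     = λ u f u′ v′ → f (u′ ++ u) v′
      ; _◁_     = λ f v u′ v′ → f u′ (v ++ v′)
      ; ▷-cong  = λ u p u′ v′ → p (u′ ++ u) v′
      ; ◁-cong  = λ v p u′ v′ → p u′ (v ++ v′)
      ; ▷-empty = λ f u′ v′ → cong (λ z → f z v′) (++-identityʳ u′)
      ; ◁-empty = λ _ _ _ → refl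
      ; ▷-++    = λ u u₁ f u′ v′ → cong (λ z → f z v′) (sym (++-assoc u′ u u₁))
      ; ◁-++    = λ f v v₁ u′ v′ → cong (f u′) (++-assoc v v₁ v′)
      ; commute = λ _ _ _ _ _ → refl
      }

    contextAutomaton : Automaton A
    contextAutomaton = automaton contexts
      (record
        { function = record
          { to   = λ w u v → output (u ++ w ++ v)
          ; cong = λ { refl _ _ → refl }
          }
        ; ▷-homo   = λ u w u′ v′ → cong output
            (trans (cong (u′ ++_) (++-assoc u w v′)) (sym (++-assoc u′ u (w ++ v′))))
        ; ◁-homo   = λ w v u′ v′ → cong (λ z → output (u′ ++ z)) (++-assoc w v v′)
        })
      (record { to = λ f → f [] [] ; cong = λ p → p [] [] })

    contextAutomaton-Accepts : contextAutomaton Accepts 𝓛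
    contextAutomaton-Accepts =
      automaton-Accepts _ _ _ λ w → cong output (++-identityʳ w)

    -- The output of `f` along `u □‾ v` is the entry `f u (v ++ [])`, so outputs recover the whole
    -- function.
    contextAutomaton-Separated : Separated contextAutomaton
    contextAutomaton-Separated {f} {g} f≃g u v =
      subst (λ z → f u z ≡ g u z) (++-identityʳ v) (f≃g u v)

    toContexts : ∀ ℬ → ℬ Accepts 𝓛 → ℬ ⇒ᴬ contextAutomaton
    toContexts ℬ acc = mkMorphism acc contextAutomaton-Accepts
      (record
        { to   = λ x u v → run ℬ (u □‾ v) x
        ; cong = λ x≈y u v → Func.cong (F₁ (Automaton.functor ℬ) (u □‾ v)) x≈y
        })
      (λ w u v → Accepts⇒output {ℬ} acc u v w)
      (λ u v x u′ v′ →
        sym (FunctorOn.homomorphism (Automaton.functor ℬ) (u′ □‾ v′) (u □ v) x))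
      (λ u v x → cong (λ z → run ℬ (u □‾ z) x) (sym (++-identityʳ v)))

    -- Morphisms preserve outputs, so two of them send a state to indistinguishable images, which
    -- separation identifies.
    contextAutomaton-isFinal : IsFinalAccepting 𝓛 contextAutomaton
    contextAutomaton-isFinal =
      contextAutomaton-Accepts , λ ℬ acc → toContexts ℬ acc , λ g → λ
      { (ι p)  → identity-at-endpoints g p
      ; states → λ x → contextAutomaton-Separated λ u v →
          trans (mapState-output g u v x)
                (sym (mapState-output (toContexts ℬ acc) u v x))
      }

    -- Reachability and separation of minimal automata

    IsInitialAccepting⇒Reachable : ∀ {𝒜} → IsInitialAccepting 𝓛 𝒜 → Reachable 𝒜
    IsInitialAccepting⇒Reachable {𝒜} (acc , init) x = w , (begin
      -- `mapState k w` is `reach 𝒜 w` by definition; uniqueness equates the endomorphisms `k ∘ᴬ g`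
      -- and `idᴬ`.
      reach 𝒜 w                         ≈⟨ proj₂ (init 𝒜 acc) (k ∘ᴬ g) states x ⟩
      mapState (proj₁ (init 𝒜 acc)) x   ≈⟨ proj₂ (init 𝒜 acc) idᴬ states x ⟨
      x                                 ∎)
      where
      open SetoidReasoning (Automaton.stateSet 𝒜)
      g : 𝒜 ⇒ᴬ wordAutomaton
      g = proj₁ (init wordAutomaton wordAutomaton-Accepts)
      k : wordAutomaton ⇒ᴬ 𝒜
      k = fromWords 𝒜 acc
      w : List A
      w = mapState g x

    IsFinalAccepting⇒Separated : ∀ {𝒜} → IsFinalAccepting 𝓛 𝒜 → Separated 𝒜
    IsFinalAccepting⇒Separated {𝒜} (acc , fin) {x} {y} x≃y = begin
      x                            ≈⟨ retract x ⟨
      -- By definition `x≃y` is an equality of `mapState g x` and `mapState g y`, so `k` applies to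
      -- it.
      mapState (k ∘ᴬ g) x          ≈⟨ Func.cong (component k states) x≃y ⟩
      mapState (k ∘ᴬ g) y          ≈⟨ retract y ⟩
      y                            ∎
      where
      open SetoidReasoning (Automaton.stateSet 𝒜)
      g : 𝒜 ⇒ᴬ contextAutomaton
      g = toContexts 𝒜 acc
      k : contextAutomaton ⇒ᴬ 𝒜
      k = proj₁ (fin contextAutomaton contextAutomaton-Accepts)
      retract : ∀ z → Setoid._≈_ (Automaton.stateSet 𝒜) (mapState (k ∘ᴬ g) z) z
      retract z = Setoid.trans (Automaton.stateSet 𝒜)
        (proj₂ (fin 𝒜 acc) (k ∘ᴬ g) states z)
        (Setoid.sym (Automaton.stateSet 𝒜) (proj₂ (fin 𝒜 acc) idᴬ states z))

    module _ {ℳ} (isMin : IsMin 𝓛 ℳ) where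
      open IsMin isMin

      IsMin⇒Accepts : ℳ Accepts 𝓛
      IsMin⇒Accepts = Accepts-reflects injection {𝓛} (proj₁ isFinal)

      -- A word reaching a preimage of `x` in `initial` also reaches `x`.
      IsMin⇒Reachable : Reachable ℳ
      IsMin⇒Reachable x with surjective states x
      ... | y , eq with IsInitialAccepting⇒Reachable {initial} isInitial y
      ... | w , reach≈y = w , Setoid.trans (Automaton.stateSet ℳ)
        (Setoid.sym (Automaton.stateSet ℳ) (mapState-reach surjection w)) (eq reach≈y)

      IsMin⇒Separated : Separated ℳ
      IsMin⇒Separated x≃y = injective states
        (IsFinalAccepting⇒Separated {final} isFinal
          (Indistinguishable-preserved injection x≃y))

    -- The syntactic congruence and the syntactic automaton

    module _ (L : Pred (List A) ℓ) (enc : 𝓛 Encodes L) where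

      infix 4 _∼ᴸ_
      _∼ᴸ_ : List A → List A → Set ℓ
      _∼ᴸ_ = _∼_ L

      -- `enc` translates membership into having output 1, which determines a two-valued output.
      -- With `output⇒∼`, the relation `∼` becomes equality of outputs in all contexts.
      ∼⇒output : ∀ {w w′} → w ∼ᴸ w′ → ∀ u v →
                 output (u ++ w ++ v) ≡ output (u ++ w′ ++ v)
      ∼⇒output p u v = ≡-of-⇔ _ _
        (Symm.⇔-sym (enc _) Comp.⇔-∘ (p u v Comp.⇔-∘ enc _))

      output⇒∼ : ∀ {w w′} → (∀ u v → output (u ++ w ++ v) ≡ output (u ++ w′ ++ v)) →
                 w ∼ᴸ w′
      output⇒∼ p u v =
        enc _ Comp.⇔-∘ (≡⇒⇔ true₂ (p u v) Comp.⇔-∘ Symm.⇔-sym (enc _))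

      ∼-resp-∈ : ∀ {w w′} → w ∼ᴸ w′ → w ∈ L → w′ ∈ L
      ∼-resp-∈ {w} {w′} p w∈L = subst L (++-identityʳ w′)
        (Equivalence.to (p [] []) (subst L (sym (++-identityʳ w)) w∈L))

      -- `L` is a union of `∼`-classes, as the empty context shows, so passing to its image adds no
      -- words.
      ∈-image : ∀ w → (w ∈ L) ⇔ (w ∈ MonoidRecognizer.P (syntactic L))
      ∈-image w = mk⇔ (λ w∈L → w , w∈L , IsEquivalence.refl (∼-isEquivalence L))
                      (λ { (w′ , w′∈L , w′∼w) → ∼-resp-∈ w′∼w w′∈L })

      synAutomaton : Automaton A
      synAutomaton = automaton R.biaction R.φ record
        -- `output` serves as the characteristic function of the image of `L`; the empty context
        -- makes it constant on classes.
        { to   = output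
        ; cong = λ {w} {w′} p → trans (cong output (sym (++-identityʳ w)))
                   (trans (∼⇒output p [] []) (cong output (++-identityʳ w′)))
        }
        where module R = BiactionRecognizer (underlying (syntactic L))

      synAutomaton-Accepts : synAutomaton Accepts 𝓛
      synAutomaton-Accepts = automaton-Accepts _ _ _ λ _ → refl

      synAutomaton-isMin : IsMin 𝓛 synAutomaton
      synAutomaton-isMin = record
        { isInitial  = wordAutomaton-isInitial
        ; isFinal    = contextAutomaton-isFinal
        -- Taking the composite as the morphism makes `factorizes` hold by definition.
        ; unique     = toContexts synAutomaton synAutomaton-Accepts
                         ∘ᴬ fromWords synAutomaton synAutomaton-Accepts
        ; surjection = fromWords synAutomaton synAutomaton-Accepts
        ; injection  = toContexts synAutomaton synAutomaton-Accepts
        ; surjective = λ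
          { (ι _)  y → y , id
          ; states w → w , λ { refl → IsEquivalence.refl (∼-isEquivalence L) }
          }
        ; injective  = λ
          { (ι _)  → id
          -- The injection sends the class of `w` to the function with entries
          -- `output (u ++ w ++ v)`.
          ; states → output⇒∼
          }
        ; factorizes = λ
          { (ι p) _ → Setoid.refl (endpoints p)
          ; states _ _ _ → refl
          }
        }

      -- The isomorphism with the syntactic recognizer

      module _ (ℳ : Automaton A) (acc : ℳ Accepts 𝓛)
               (reachable : Reachable ℳ) (separated : Separated ℳ) where
        private
          module R = BiactionRecognizer (recognizer ℳ)
          module φ = BiactionMorphism R.φ

          label : R.Carrier → List A
          label x = proj₁ (reachable x)

          reach-label : ∀ x → reach ℳ (label x) R.≈ x
          reach-label x = proj₂ (reachable x)

        reach-reflects : ∀ {w w′} → reach ℳ w R.≈ reach ℳ w′ → w ∼ᴸ w′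
        reach-reflects {w} {w′} eq = output⇒∼ λ u v →
          trans (sym (Accepts⇒output {ℳ} acc u v w))
          (trans (Func.cong (F₁ (Automaton.functor ℳ) (u □‾ v)) eq)
                 (Accepts⇒output {ℳ} acc u v w′))

        reach-resp : ∀ {w w′} → w ∼ᴸ w′ → reach ℳ w R.≈ reach ℳ w′
        reach-resp {w} {w′} p = separated λ u v →
          trans (Accepts⇒output {ℳ} acc u v w)
          (trans (∼⇒output p u v) (sym (Accepts⇒output {ℳ} acc u v w′)))

        reach-∈ : ∀ w → (reach ℳ w ∈ R.P) ⇔ (w ∈ L)
        reach-∈ w = enc w Comp.⇔-∘ ≡⇒⇔ true₂
          (trans (Accepts⇒output {ℳ} acc [] [] w) (cong output (++-identityʳ w)))

        label-∈ : ∀ x → (x ∈ R.P) ⇔ (label x ∈ L)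
        label-∈ x = reach-∈ (label x) Comp.⇔-∘
          mk⇔ (R.P-resp-≈ (R.sym (reach-label x))) (R.P-resp-≈ (reach-label x))

        -- `label` chooses words without regard to the actions; its laws hold only up to `∼`, where
        -- `reach-reflects` reduces them to equalities of states.
        reachable-separated⇒≅ : recognizer ℳ ≅ underlying (syntactic L)
        reachable-separated⇒≅ = record
          { forward  = record
            { morphism = record
              { function = record
                { to   = label
                ; cong = λ x≈y → reach-reflects
                    (R.trans (reach-label _) (R.trans x≈y (R.sym (reach-label _))))
                }
              -- Both `label (u ▷ x)` and `u ++ label x` reach `u ▷ x`; the right action is
              -- symmetric.
              ; ▷-homo = λ u x → reach-reflects (R.trans (reach-label _)
                  (R.trans (R.▷-cong u (R.sym (reach-label x)))
                           (R.sym (φ.▷-homo u (label x)))))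
              ; ◁-homo = λ x v → reach-reflects (R.trans (reach-label _)
                  (R.trans (R.◁-cong v (R.sym (reach-label x)))
                           (R.sym (φ.◁-homo (label x) v))))
              }
            ; preserves-φ = λ w → reach-reflects (reach-label _)
            ; preserves-P = λ x → ∈-image (label x) Comp.⇔-∘ label-∈ x
            }
          ; backward = record
            { morphism = record
              -- `reach ℳ` is the map `φ` of `recognizer ℳ`, so it inherits the biaction laws.
              { function = record { to = reach ℳ ; cong = reach-resp }
              ; ▷-homo   = φ.▷-homo
              ; ◁-homo   = φ.◁-homo
              }
            ; preserves-φ = λ _ → R.refl
            ; preserves-P = λ w → Symm.⇔-sym (reach-∈ w) Comp.⇔-∘ Symm.⇔-sym (∈-image w)
            }
          ; backward∘forward = reach-label
          ; forward∘backward = λ w → reach-reflects (reach-label _)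
          }

theorem6p9 : ∀ {ℓ} (A : Set ℓ) (L : Pred (List A) ℓ) (𝓛 : LanguageFunctor A) →
    𝓛 Encodes L →
    (Σ[ ℳ ∈ Automaton A ] IsMin 𝓛 ℳ) ×
    (∀ (ℳ : Automaton A) → IsMin 𝓛 ℳ → recognizer ℳ ≅ underlying (syntactic L))
theorem6p9 A L 𝓛 enc =
  (synAutomaton 𝓛 L enc , synAutomaton-isMin 𝓛 L enc) ,
  λ ℳ isMin → reachable-separated⇒≅ 𝓛 L enc ℳ
    (IsMin⇒Accepts 𝓛 isMin) (IsMin⇒Reachable 𝓛 isMin) (IsMin⇒Separated 𝓛 isMin)
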